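{- If $G$ is a graph of order $n$ whose Seidel matrix is singular, then $n\equiv 1\pmod 4$.
   Context: All graphs are simple, undirected, finite, with at least one vertex. The order of a graph is its number of vertices. For a graph $G$ with vertices $v_1,\dots,v_n$ and adjacency matrix $A$, the Seidel matrix of $G$ is $S=J_n-I_n-2A$, where $J_n$ is the all-ones $n\times n$ matrix and $I_n$ the identity. -}

module Defs where

open import Algebra.Properties.Monoid.Sum using (sum)
open import Data.Bool.Base using (if_then_else_)
open import Data.Fin.Base using (Fin; zero; suc; toℕ; punchIn)
open import Data.Fin.Properties using (_≟_)
open import Data.Integer.Base using (ℤ; 0ℤ; 1ℤ; -1ℤ; +_; _-_; _*_; _^_)
open import Data.Integer.Properties using (+-0-monoid)
open import Data.Nat.Base using (ℕ; zero; suc)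
open import Level using (0ℓ)
open import Relation.Binary.Core using (Rel)
open import Relation.Binary.Definitions using (Symmetric; Irreflexive; Decidable)
open import Relation.Binary.PropositionalEquality.Core using (_≡_)
open import Relation.Nullary.Decidable using (does)

-- Simple undirected graphs with vertices v₁,…,vₙ given by Fin n.  Decidability
-- of adjacency is what makes the 0/1 adjacency matrix definable.
record Graph (n : ℕ) : Set₁ where
  field
    _~_    : Rel (Fin n) 0ℓ
    _~?_   : Decidable _~_
    sym    : Symmetric _~_
    irrefl : Irreflexive _≡_ _~_

Matrix : ℕ → Set
Matrix n = Fin n → Fin n → ℤ

allOnes : ∀ n → Matrix n
allOnes n i j = 1ℤ

identity : ∀ n → Matrix n
identity n i j = if does (i ≟ j) then 1ℤ else 0ℤ

adjacency : ∀ {n} → Graph n → Matrix n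
adjacency G i j = if does (i ~? j) then 1ℤ else 0ℤ
  where open Graph G

seidel : ∀ {n} → Graph n → Matrix n
seidel {n} G i j = allOnes n i j - identity n i j - + 2 * adjacency G i j

minor : ∀ {n} → Matrix (suc n) → Fin (suc n) → Fin (suc n) → Matrix n
minor M i j k l = M (punchIn i k) (punchIn j l)

-- Cofactor expansion along the first row.
det : ∀ {n} → Matrix n → ℤ
det {zero}  M = 1ℤ
det {suc n} M =
  sum +-0-monoid (λ j → -1ℤ ^ toℕ j * M zero j * det (minor M zero j))

-- The determinant of an integer matrix is the same integer whether computed
-- over ℤ, ℚ or ℝ, so this is singularity as a real matrix.
Singular : ∀ {n} → Matrix n → Set
Singular M = det M ≡ 0ℤ

{-# OPTIONS --safe #-}

-- The determinant of a symmetric integer matrix modulo 4 depends only on its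
-- diagonal modulo 4 and its off-diagonal entries modulo 2: expand along the
-- first row and the first column, and pair the term at (i , j) with the equal
-- term at (j , i).  Hence det S ≡ det (J - I) (mod 4).  Writing h n for
-- det (Jₙ - Iₙ), subtracting the second row from the first gives
-- h (n + 2) = - 2 h (n + 1) - h n, so h has period 4 modulo 4 with residues
-- 1, 0, -1, 2.
module Submission where

open import Defs
open import Data.Bool.Base using (if_then_else_)
open import Data.Fin.Base using (Fin; zero; suc; toℕ; punchIn)
open import Data.Fin.Properties using (_≟_)
open import Data.Integer.Base using (ℤ; 0ℤ; 1ℤ; -1ℤ; +_; _+_; _-_; -_; _*_; _^_)
open import Data.Integer.Divisibility.Signed
  using (_∣_; divides; _∣?_; ∣m∣n⇒∣m+n; ∣n⇒∣m*n)
open import Data.Integer.Properties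
  using (+-*-semiring; +-inverseʳ; +-identityˡ; +-identityʳ; *-identityˡ; *-zeroˡ; *-zeroʳ)
open import Data.Integer.Tactic.RingSolver using (solve-∀)
open import Data.Nat.Base using (ℕ; zero; suc; NonZero; _%_)
open import Function.Base using (flip)
open import Function.Bundles using (mk⇔)
open import Relation.Binary.PropositionalEquality
  using (_≡_; refl; sym; trans; cong; cong₂; subst; subst₂; module ≡-Reasoning)
open import Relation.Nullary.Decidable using (does-⇔; dec-false; from-no)
open import Relation.Nullary.Negation using (contradiction)

open import Algebra.Properties.Semiring.Sum +-*-semiring
  using (sum; sum-cong-≗; sum-replicate-zero; ∑-distrib-+; ∑-comm; *-distribˡ-sum)

private
  variable
    n : ℕ
    k x y x′ y′ : ℤ

-- Congruence of integers.

infix 4 _≋_[mod_]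

-- A record instead of a synonym, so that `x` and `y` can be inferred from the type; the difference
-- `x - y` alone does not determine them.
record _≋_[mod_] (x y k : ℤ) : Set where
  constructor ∣⇒≋
  field ≋⇒∣ : k ∣ x - y

open _≋_[mod_]

≋-reflexive : x ≡ y → x ≋ y [mod k ]
≋-reflexive {x} {k = k} refl = ∣⇒≋ (divides 0ℤ (trans (+-inverseʳ x) (sym (*-zeroˡ k))))

≋-refl : x ≋ x [mod k ]
≋-refl = ≋-reflexive refl

≋-+ : x ≋ x′ [mod k ] → y ≋ y′ [mod k ] → x + y ≋ x′ + y′ [mod k ]
≋-+ {x} {x′} {k} {y} {y′} (∣⇒≋ p) (∣⇒≋ q) = ∣⇒≋ (subst (k ∣_) (regroup x x′ y y′) (∣m∣n⇒∣m+n p q))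
  where
  regroup : ∀ x x′ y y′ → (x - x′) + (y - y′) ≡ (x + y) - (x′ + y′)
  regroup = solve-∀

≋-* : x ≋ x′ [mod k ] → y ≋ y′ [mod k ] → x * y ≋ x′ * y′ [mod k ]
≋-* {x} {x′} {k} {y} {y′} (∣⇒≋ p) (∣⇒≋ q) =
  ∣⇒≋ (subst (k ∣_) (regroup x x′ y y′) (∣m∣n⇒∣m+n (∣n⇒∣m*n y p) (∣n⇒∣m*n x′ q)))
  where
  regroup : ∀ x x′ y y′ → y * (x - x′) + x′ * (y - y′) ≡ x * y - x′ * y′
  regroup = solve-∀

≋-sum : (f g : Fin n → ℤ) → (∀ i → f i ≋ g i [mod k ]) → sum f ≋ sum g [mod k ]
≋-sum {zero}  f g f≋g = ≋-refl
≋-sum {suc n} f g f≋g =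
  ≋-+ (f≋g zero) (≋-sum (λ i → f (suc i)) (λ i → g (suc i)) (λ i → f≋g (suc i)))

double-≋ : x ≋ y [mod + 2 ] → x + x ≋ y + y [mod + 4 ]
double-≋ {x} {y} (∣⇒≋ (divides q x-y≡q*2)) =
  ∣⇒≋ (divides q (trans (regroup x y) (trans (cong₂ _+_ x-y≡q*2 x-y≡q*2) (double q))))
  where
  regroup : ∀ x y → (x + x) - (y + y) ≡ (x - y) + (x - y)
  regroup = solve-∀
  double : ∀ q → q * + 2 + q * + 2 ≡ q * + 4
  double = solve-∀

-- Both factors of `(x - y) * ((x - y) + 2y)` are even.
square-≋ : x ≋ y [mod + 2 ] → x * x ≋ y * y [mod + 4 ]
square-≋ {x} {y} (∣⇒≋ (divides q x-y≡q*2)) =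
  ∣⇒≋ (divides (q * (q + y))
    (trans (factor x y) (trans (cong (λ d → d * (d + + 2 * y)) x-y≡q*2) (collect q y))))
  where
  factor : ∀ x y → x * x - y * y ≡ (x - y) * ((x - y) + + 2 * y)
  factor = solve-∀
  collect : ∀ q y → (q * + 2) * (q * + 2 + + 2 * y) ≡ q * (q + y) * + 4
  collect = solve-∀

-- Symmetric double sums modulo 4.

double-sum-suc : (f : Fin (suc n) → Fin (suc n) → ℤ) → (∀ i j → f i j ≡ f j i) →
  sum (λ i → sum (f i)) ≡
  f zero zero + (sum (λ i → f (suc i) zero + f (suc i) zero)
    + sum (λ i → sum (λ j → f (suc i) (suc j))))
double-sum-suc {n} f f-sym = begin
  (f₀₀ + sum (λ j → f zero (suc j))) + sum (λ i → f (suc i) zero + sum (λ j → f (suc i) (suc j)))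
    ≡⟨ cong₂ (λ r s → (f₀₀ + r) + s) (sum-cong-≗ λ j → f-sym zero (suc j)) (∑-distrib-+ c _) ⟩
  (f₀₀ + sum c) + (sum c + inner)
    ≡⟨ regroup f₀₀ (sum c) inner ⟩
  f₀₀ + ((sum c + sum c) + inner)
    ≡⟨ cong (λ s → f₀₀ + (s + inner)) (∑-distrib-+ c c) ⟨
  f₀₀ + (sum (λ i → c i + c i) + inner) ∎
  where
  open ≡-Reasoning
  f₀₀ inner : ℤ
  f₀₀ = f zero zero
  inner = sum (λ i → sum (λ j → f (suc i) (suc j)))
  c : Fin n → ℤ
  c i = f (suc i) zero
  regroup : ∀ x y z → (x + y) + (y + z) ≡ x + ((y + y) + z)
  regroup = solve-∀

-- Off the diagonal each value occurs twice by symmetry, and twice an integer is determined modulo 4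
-- by its parity. The induction peels off the first row together with the first column.
double-sum-≋ : (f g : Fin n → Fin n → ℤ) →
  (∀ i j → f i j ≡ f j i) → (∀ i j → g i j ≡ g j i) →
  (∀ i → f i i ≋ g i i [mod + 4 ]) → (∀ i j → f i j ≋ g i j [mod + 2 ]) →
  sum (λ i → sum (f i)) ≋ sum (λ i → sum (g i)) [mod + 4 ]
double-sum-≋ {zero} f g _ _ _ _ = ≋-refl
double-sum-≋ {suc n} f g f-sym g-sym diag off =
  subst₂ (λ x y → x ≋ y [mod + 4 ]) (sym (double-sum-suc f f-sym)) (sym (double-sum-suc g g-sym))
  (≋-+ (diag zero) (≋-+
    (≋-sum (λ i → f (suc i) zero + f (suc i) zero) (λ i → g (suc i) zero + g (suc i) zero)
      (λ i → double-≋ (off (suc i) zero)))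
    (double-sum-≋ (λ i j → f (suc i) (suc j)) (λ i j → g (suc i) (suc j))
      (λ i j → f-sym (suc i) (suc j)) (λ i j → g-sym (suc i) (suc j))
      (λ i → diag (suc i)) (λ i j → off (suc i) (suc j)))))

-- Cofactor expansions and the transpose.

sign : Fin n → ℤ
sign i = -1ℤ ^ toℕ i

det-cong : {M N : Matrix n} → (∀ i j → M i j ≡ N i j) → det M ≡ det N
det-cong {zero}  M≡N = refl
det-cong {suc n} M≡N = sum-cong-≗ λ j →
  cong₂ (λ a d → sign j * a * d) (M≡N zero j)
    (det-cong λ k l → M≡N (suc k) (punchIn j l))

det-≋ : (M N : Matrix n) → (∀ i j → M i j ≋ N i j [mod k ]) → det M ≋ det N [mod k ]
det-≋ {zero}  M N M≋N = ≋-refl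
det-≋ {suc n} M N M≋N = ≋-sum _ _ λ j →
  ≋-* (≋-* (≋-refl {sign j}) (M≋N zero j))
    (det-≋ (minor M zero j) (minor N zero j) λ k l → M≋N (suc k) (punchIn j l))

-- Stated for one size at a time, so that the expansions below can assume it for smaller sizes only
-- and then serve in its own induction.
DetTranspose : ℕ → Set
DetTranspose n = (M : Matrix n) → det M ≡ det (flip M)

column-expansion : DetTranspose n → DetTranspose (suc n) → (M : Matrix (suc n)) →
  det M ≡ sum (λ i → sign i * M i zero * det (minor M i zero))
column-expansion tr tr⁺ M = trans (tr⁺ M) (sum-cong-≗ λ i →
  cong (sign i * M i zero *_) (sym (tr (minor M i zero))))

-- A term of Cauchy's expansion of a bordered determinant: an entry of the first row, an entry of
-- the first column, and the minor avoiding both of their rows and columns.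
border : (M : Matrix (suc (suc n))) → Fin (suc n) → Fin (suc n) → ℤ
border M j i =
  sign j * sign i * (M zero (suc j) * M (suc i) zero) * det (minor (minor M zero zero) i j)

-- Expand along the first row, then expand every minor but the corner one along its first column.
-- The factor `-1ℤ` comes from `sign (suc j)`.
border-expansion : DetTranspose n → DetTranspose (suc n) → (M : Matrix (suc (suc n))) →
  det M ≡ M zero zero * det (minor M zero zero) + -1ℤ * sum (λ j → sum (border M j))
border-expansion tr tr⁺ M = cong₂ _+_
  (cong (_* det (minor M zero zero)) (*-identityˡ (M zero zero)))
  (trans (sum-cong-≗ step) (sym (*-distribˡ-sum -1ℤ (λ j → sum (border M j)))))
  where
  open ≡-Reasoning
  regroup : ∀ s r t c d → -1ℤ * s * r * (t * c * d) ≡ -1ℤ * (s * t * (r * c) * d)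
  regroup = solve-∀
  step : ∀ j → -1ℤ * sign j * M zero (suc j) * det (minor M zero (suc j)) ≡ -1ℤ * sum (border M j)
  step j = begin
    u * det (minor M zero (suc j))
      ≡⟨ cong (u *_) (column-expansion tr tr⁺ (minor M zero (suc j))) ⟩
    u * sum v
      ≡⟨ *-distribˡ-sum u v ⟩
    sum (λ i → u * v i)
      ≡⟨ sum-cong-≗ (λ i → regroup (sign j) (M zero (suc j)) (sign i) (M (suc i) zero)
                             (det (minor (minor M zero zero) i j))) ⟩
    sum (λ i → -1ℤ * border M j i)
      ≡⟨ *-distribˡ-sum -1ℤ (border M j) ⟨
    -1ℤ * sum (border M j) ∎
    where
    u : ℤ
    u = -1ℤ * sign j * M zero (suc j)
    v : Fin _ → ℤ
    v i = sign i * M (suc i) zero * det (minor (minor M zero zero) i j)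

-- Transposing `M` exchanges the two indices of the border sum and transposes the minors, which are
-- covered by the two smaller sizes.
det-transpose-step : DetTranspose n → DetTranspose (suc n) → DetTranspose (suc (suc n))
det-transpose-step tr tr⁺ M = begin
  det M
    ≡⟨ border-expansion tr tr⁺ M ⟩
  M zero zero * det (minor M zero zero) + -1ℤ * sum (λ j → sum (border M j))
    ≡⟨ cong₂ (λ d s → M zero zero * d + -1ℤ * s) (tr⁺ (minor M zero zero)) swap ⟩
  M zero zero * det (minor (flip M) zero zero) + -1ℤ * sum (λ j → sum (border (flip M) j))
    ≡⟨ border-expansion tr tr⁺ (flip M) ⟨
  det (flip M) ∎
  where
  open ≡-Reasoning
  regroup : ∀ s t r c d → s * t * (r * c) * d ≡ t * s * (c * r) * d
  regroup = solve-∀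
  swap : sum (λ j → sum (border M j)) ≡ sum (λ j → sum (border (flip M) j))
  swap = trans (∑-comm (border M)) (sum-cong-≗ λ i → sum-cong-≗ λ j →
    trans (regroup (sign j) (sign i) (M zero (suc j)) (M (suc i) zero) _)
      (cong (sign i * sign j * (M (suc i) zero * M zero (suc j)) *_)
        (tr (minor (minor M zero zero) i j))))

det-transpose : ∀ n → DetTranspose n
det-transpose zero          M = refl
det-transpose (suc zero)    M = refl
det-transpose (suc (suc n)) = det-transpose-step (det-transpose n) (det-transpose (suc n))

-- Determinants of symmetric matrices modulo 4.

IsSymmetric : Matrix n → Set
IsSymmetric M = ∀ i j → M i j ≡ M j i

minor-symmetric : {M : Matrix (suc n)} → IsSymmetric M → ∀ i → IsSymmetric (minor M i i)
minor-symmetric M-sym i k l = M-sym (punchIn i k) (punchIn i l)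

-- Exchanging `i` and `j` transposes the inner minor, because `M` is symmetric.
border-symmetric : {M : Matrix (suc (suc n))} → IsSymmetric M →
  ∀ i j → border M i j ≡ border M j i
border-symmetric {n} {M} M-sym i j = trans
  (cong₂ (λ c d → sign i * sign j * c * d)
    (cong₂ _*_ (M-sym zero (suc i)) (M-sym (suc j) zero))
    (trans (det-transpose n (minor (minor M zero zero) j i))
      (det-cong λ k l → M-sym (suc (punchIn j l)) (suc (punchIn i k)))))
  (regroup (sign i) (sign j) (M (suc i) zero) (M zero (suc j)) _)
  where
  regroup : ∀ s t r c d → s * t * (r * c) * d ≡ t * s * (c * r) * d
  regroup = solve-∀

-- Induction through the border expansion, applied to the corner minor and to the principal minors
-- one size smaller, all of them symmetric.
det-symmetric-≋ : (M N : Matrix n) → IsSymmetric M → IsSymmetric N →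
  (∀ i → M i i ≋ N i i [mod + 4 ]) → (∀ i j → M i j ≋ N i j [mod + 2 ]) →
  det M ≋ det N [mod + 4 ]
det-symmetric-≋ {zero} M N _ _ _ _ = ≋-refl
det-symmetric-≋ {suc zero} M N _ _ diag _ =
  ≋-+ (≋-* (≋-* (≋-refl {1ℤ}) (diag zero)) (≋-refl {1ℤ})) (≋-refl {0ℤ})
det-symmetric-≋ {suc (suc n)} M N M-sym N-sym diag off =
  subst₂ (λ x y → x ≋ y [mod + 4 ])
    (sym (border-expansion (det-transpose n) (det-transpose (suc n)) M))
    (sym (border-expansion (det-transpose n) (det-transpose (suc n)) N))
    (≋-+
      (≋-* (diag zero)
        (det-symmetric-≋ M₁ N₁ M₁-sym N₁-sym (λ k → diag (suc k)) (λ k l → off (suc k) (suc l))))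
      (≋-* (≋-refl { -1ℤ})
        (double-sum-≋ (border M) (border N) (border-symmetric M-sym) (border-symmetric N-sym)
          border-diag border-off)))
  where
  M₁ N₁ : Matrix (suc n)
  M₁ = minor M zero zero
  N₁ = minor N zero zero

  M₁-sym : IsSymmetric M₁
  M₁-sym = minor-symmetric M-sym zero
  N₁-sym : IsSymmetric N₁
  N₁-sym = minor-symmetric N-sym zero

  -- These inner minors need not be symmetric, so only their parity is controlled; it suffices
  -- because the terms occur in equal pairs.
  border-off : ∀ i j → border M i j ≋ border N i j [mod + 2 ]
  border-off i j =
    ≋-* (≋-* (≋-refl {sign i * sign j}) (≋-* (off zero (suc i)) (off (suc j) zero)))
      (det-≋ (minor M₁ j i) (minor N₁ j i)
        (λ k l → off (suc (punchIn j k)) (suc (punchIn i l))))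

  border-diag : ∀ i → border M i i ≋ border N i i [mod + 4 ]
  border-diag i =
    -- A diagonal term has no partner, but its row and column entries agree, so their product is a
    -- square and parity fixes it modulo 4.
    ≋-* (≋-* (≋-refl {sign i * sign i})
          (subst₂ (λ x y → M zero (suc i) * x ≋ N zero (suc i) * y [mod + 4 ])
            (M-sym zero (suc i)) (N-sym zero (suc i)) (square-≋ (off zero (suc i)))))
      (det-symmetric-≋ (minor M₁ i i) (minor N₁ i i)
        (minor-symmetric M₁-sym i) (minor-symmetric N₁-sym i)
        (λ k → diag (suc (punchIn i k)))
        (λ k l → off (suc (punchIn i k)) (suc (punchIn i l))))

-- Row operations on determinants.

det-equal-rows : ∀ n (M : Matrix (suc (suc n))) →
  (∀ j → M zero j ≡ M (suc zero) j) → det M ≡ 0ℤ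
det-equal-rows n M rows = begin
  det M
    -- Along the first column the first two terms cancel, their minors being equal, and every later
    -- minor keeps both equal rows and vanishes by induction.
    ≡⟨ column-expansion (det-transpose (suc n)) (det-transpose (suc (suc n))) M ⟩
  1ℤ * M zero zero * d + (-1ℤ * 1ℤ * M (suc zero) zero * det (minor M (suc zero) zero) + sum rest)
    ≡⟨ cong₂ (λ a s → 1ℤ * M zero zero * d + (a + s))
         (cong₂ (λ a e → -1ℤ * 1ℤ * a * e) (sym (rows zero)) (det-cong minors))
         (trans (sum-cong-≗ (rest≡0 n M rows)) (sum-replicate-zero n)) ⟩
  1ℤ * M zero zero * d + (-1ℤ * 1ℤ * M zero zero * d + 0ℤ)
    ≡⟨ cancel (M zero zero) d ⟩
  0ℤ ∎
  where
  open ≡-Reasoning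
  d : ℤ
  d = det (minor M zero zero)
  rest : Fin n → ℤ
  rest i = sign (suc (suc i)) * M (suc (suc i)) zero * det (minor M (suc (suc i)) zero)
  minors : ∀ k l → minor M (suc zero) zero k l ≡ minor M zero zero k l
  minors zero    l = rows (suc l)
  minors (suc k) l = refl
  cancel : ∀ a d → 1ℤ * a * d + (-1ℤ * 1ℤ * a * d + 0ℤ) ≡ 0ℤ
  cancel = solve-∀
  -- `n` is quantified afresh: the index `i` forces it to be a successor, as the recursive call
  -- requires.
  rest≡0 : ∀ n (M : Matrix (suc (suc n))) → (∀ j → M zero j ≡ M (suc zero) j) →
    ∀ i → sign (suc (suc i)) * M (suc (suc i)) zero * det (minor M (suc (suc i)) zero) ≡ 0ℤ
  rest≡0 (suc n) M rows i =
    trans (cong (u *_) (det-equal-rows n (minor M (suc (suc i)) zero) λ j → rows (suc j)))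
      (*-zeroʳ u)
    where
    u : ℤ
    u = sign (suc (suc i)) * M (suc (suc i)) zero

-- By linearity in the first row, the discarded part is the determinant of `M′`, which repeats the
-- second row of `M`.
det-subtract-row : (M : Matrix (suc (suc n))) →
  det M ≡ sum (λ j → sign j * (M zero j - M (suc zero) j) * det (minor M zero j))
det-subtract-row {n} M = begin
  det M
    ≡⟨ sum-cong-≗ (λ j → split (sign j) (M zero j) (M (suc zero) j) (det (minor M zero j))) ⟩
  sum (λ j → difference j + repeated j)
    ≡⟨ ∑-distrib-+ difference repeated ⟩
  sum difference + sum repeated
    ≡⟨ cong (λ s → sum difference + s) (det-equal-rows n M′ λ j → refl) ⟩
  sum difference + 0ℤ
    ≡⟨ +-identityʳ (sum difference) ⟩
  sum difference ∎
  where
  open ≡-Reasoning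
  M′ : Matrix (suc (suc n))
  M′ zero    = M (suc zero)
  M′ (suc i) = M (suc i)
  difference repeated : Fin (suc (suc n)) → ℤ
  difference j = sign j * (M zero j - M (suc zero) j) * det (minor M zero j)
  repeated j = sign j * M (suc zero) j * det (minor M zero j)
  split : ∀ s a b d → s * a * d ≡ s * (a - b) * d + s * b * d
  split = solve-∀

-- The determinants of J - I, the Seidel matrices of edgeless graphs.

hollow : ∀ n → Matrix n
hollow n i j = allOnes n i j - identity n i j

h : ℕ → ℤ
h n = det (hollow n)

-- By linearity in the corner entry: raising it from 0 to 1 in `hollow (suc n)` adds the corner
-- minor `h n`.
det-hollow-corner : ∀ n (B : Matrix (suc n)) → B zero zero ≡ 1ℤ →
  (∀ j → B zero (suc j) ≡ 1ℤ) → (∀ i j → B (suc i) j ≡ hollow (suc n) (suc i) j) →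
  det B ≡ h n + h (suc n)
det-hollow-corner n B corner row rest = cong₂ _+_
  (trans (cong₂ (λ a d → 1ℤ * a * d) corner (det-cong λ k l → rest k (suc l)))
    (*-identityˡ (h n)))
  (trans
    (sum-cong-≗ λ j → cong₂ (λ a d → sign (suc j) * a * d) (row j)
      (det-cong λ k l → rest k (punchIn (suc j) l)))
    (sym (+-identityˡ _)))

-- The first row minus the second is (-1, 1, 0, ..., 0), so two minors survive: `hollow (suc n)` and
-- the same matrix with corner entry 1.
h-recurrence : ∀ n → h (suc (suc n)) ≡ - (+ 2 * h (suc n) + h n)
h-recurrence n = begin
  h (suc (suc n))
    ≡⟨ det-subtract-row H ⟩
  -1ℤ * h (suc n) + (-1ℤ * det (minor H zero (suc zero)) + sum rest)
    ≡⟨ cong₂ (λ d s → -1ℤ * h (suc n) + (-1ℤ * d + s))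
         (det-hollow-corner n (minor H zero (suc zero)) refl (λ j → refl) corner-rest)
         (trans (sum-cong-≗ rest≡0) (sum-replicate-zero n)) ⟩
  -1ℤ * h (suc n) + (-1ℤ * (h n + h (suc n)) + 0ℤ)
    ≡⟨ collect (h n) (h (suc n)) ⟩
  - (+ 2 * h (suc n) + h n) ∎
  where
  open ≡-Reasoning
  H : Matrix (suc (suc n))
  H = hollow (suc (suc n))
  rest : Fin n → ℤ
  rest j = sign (suc (suc j)) * 0ℤ * det (minor H zero (suc (suc j)))
  rest≡0 : ∀ j → rest j ≡ 0ℤ
  rest≡0 j = trans (cong (_* det (minor H zero (suc (suc j)))) (*-zeroʳ (sign (suc (suc j)))))
    (*-zeroˡ (det (minor H zero (suc (suc j)))))
  corner-rest : ∀ i j → minor H zero (suc zero) (suc i) j ≡ hollow (suc n) (suc i) j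
  corner-rest i zero    = refl
  corner-rest i (suc j) = refl
  collect : ∀ a b → -1ℤ * b + (-1ℤ * (a + b) + 0ℤ) ≡ - (+ 2 * b + a)
  collect = solve-∀

-- The recurrence modulo 4.

module _ (a : ℕ → ℤ) (a₀ : a 0 ≡ 1ℤ) (a₁ : a 1 ≡ 0ℤ)
  (recurrence : ∀ n → a (suc (suc n)) ≡ - (+ 2 * a (suc n) + a n)) where

  -- Three uses of the recurrence give a(n+4) = -3 a(n) - 4 a(n+1).
  recurrence-period : ∀ n → a n ≡ a (suc (suc (suc (suc n)))) + (a n + a (suc n)) * + 4
  recurrence-period n
    rewrite recurrence (suc (suc n)) | recurrence (suc n) | recurrence n =
    collect (a n) (a (suc n))
    where
    collect : ∀ x y →
      x ≡ - (+ 2 * - (+ 2 * - (+ 2 * y + x) + y) + - (+ 2 * y + x)) + (x + y) * + 4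
    collect = solve-∀

  4∣recurrence⇒n%4≡1 : ∀ n → + 4 ∣ a n → n % 4 ≡ 1
  4∣recurrence⇒n%4≡1 0 4∣a rewrite a₀ = contradiction 4∣a (from-no (+ 4 ∣? 1ℤ))
  4∣recurrence⇒n%4≡1 1 4∣a = refl
  4∣recurrence⇒n%4≡1 2 4∣a rewrite recurrence 0 | a₁ | a₀ =
    contradiction 4∣a (from-no (+ 4 ∣? -1ℤ))
  4∣recurrence⇒n%4≡1 3 4∣a rewrite recurrence 1 | recurrence 0 | a₁ | a₀ =
    contradiction 4∣a (from-no (+ 4 ∣? + 2))
  4∣recurrence⇒n%4≡1 (suc (suc (suc (suc n)))) 4∣a = 4∣recurrence⇒n%4≡1 n
    (subst (+ 4 ∣_) (sym (recurrence-period n))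
      (∣m∣n⇒∣m+n 4∣a (divides (a n + a (suc n)) refl)))

-- Seidel matrices compared with J - I.

identity-symmetric : IsSymmetric (identity n)
identity-symmetric i j =
  cong (λ b → if b then 1ℤ else 0ℤ) (does-⇔ (mk⇔ sym sym) (i ≟ j) (j ≟ i))

hollow-symmetric : IsSymmetric (hollow n)
hollow-symmetric i j = cong (λ a → 1ℤ - a) (identity-symmetric i j)

module _ (G : Graph n) where
  open Graph G using (_~?_; irrefl) renaming (sym to ~-sym)

  adjacency-symmetric : IsSymmetric (adjacency G)
  adjacency-symmetric i j =
    cong (λ b → if b then 1ℤ else 0ℤ) (does-⇔ (mk⇔ ~-sym ~-sym) (i ~? j) (j ~? i))

  seidel-symmetric : IsSymmetric (seidel G)
  seidel-symmetric i j =
    cong₂ (λ a b → a - + 2 * b) (hollow-symmetric i j) (adjacency-symmetric i j)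

  seidel-diagonal : ∀ i → seidel G i i ≡ hollow n i i
  seidel-diagonal i = trans
    (cong (λ b → hollow n i i - + 2 * (if b then 1ℤ else 0ℤ)) (dec-false (i ~? i) (irrefl refl)))
    (subtract-zero (hollow n i i))
    where
    subtract-zero : ∀ a → a - + 2 * 0ℤ ≡ a
    subtract-zero = solve-∀

  seidel≋hollow : ∀ i j → seidel G i j ≋ hollow n i j [mod + 2 ]
  seidel≋hollow i j =
    ∣⇒≋ (divides (- adjacency G i j) (cancel (hollow n i j) (adjacency G i j)))
    where
    cancel : ∀ a b → a - + 2 * b - a ≡ - b * + 2
    cancel = solve-∀

  det-seidel : det (seidel G) ≋ h n [mod + 4 ]
  det-seidel = det-symmetric-≋ (seidel G) (hollow n) seidel-symmetric hollow-symmetric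
    (λ i → ≋-reflexive (seidel-diagonal i)) seidel≋hollow

corollary3p3 : (n : ℕ) → .{{_ : NonZero n}} → (G : Graph n) →
    Singular (seidel G) → n % 4 ≡ 1
corollary3p3 n G singular = 4∣recurrence⇒n%4≡1 h refl refl h-recurrence n
  -- Singularity turns the congruence into divisibility of `0ℤ - h n` by 4; the factor `-1ℤ`
  -- restores the sign.
  (subst (+ 4 ∣_) (trans (cong (λ d → -1ℤ * (d - h n)) singular) (negate (h n)))
    (∣n⇒∣m*n -1ℤ (≋⇒∣ (det-seidel G))))
  where
  negate : ∀ a → -1ℤ * (0ℤ - a) ≡ a
  negate = solve-∀
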